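{- Let $k\ge 1$ be an integer and let $p=\lceil k/2\rceil$. There is a constant $c_p>0$ depending only on $p$ such that, for every sufficiently large $n$ (depending on $k$), every $n$-vertex ordered graph $(G,\prec)$ that is ordered along a Hamiltonian path and is $k$-non-crossing contains an induced path with at least $c_p\left(\frac{\log n}{\log\log n}\right)^{1/p}$ vertices.
   Context: Graphs are finite and simple. An ordered graph $(G,\prec)$ is a graph $G$ with a total order $\prec$ on $V(G)$. It is ordered along a Hamiltonian path if, writing $V(G)=\{v_1\prec\dots\prec v_n\}$, $v_iv_{i+1}\in E(G)$ for every $1\le i<n$. A crossing is a pair of edges $ab$, $cd$ with $a\prec c\prec b\prec d$. A set of edges is non-crossing if it contains no crossing. $(G,\prec)$ is $k$-non-crossing if $E(G)$ can be partitioned into $k$ (possibly empty) non-crossing sets. -}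

module Defs where

open import Level using (0ℓ)
open import Data.Nat as ℕ using (ℕ; suc)
open import Data.Integer using (ℤ; +_; -[1+_])
open import Data.Rational
  using (ℚ; 0ℚ; ½; _/_; _*_; _<_; ↥_; ↧ₙ_; +-*-rawSemiring)
open import Algebra.Definitions.RawSemiring +-*-rawSemiring using (_^_)
open import Data.Fin as Fin using (Fin; toℕ)
open import Data.Product using (Σ; ∃; ∃₂; ∃!; _×_)
open import Data.Sum using (_⊎_)
open import Function.Bundles using (_↔_; _⇔_)
open import Function.Definitions using (Injective; Surjective)
open import Relation.Binary.Core using (Rel)
open import Relation.Binary.Definitions
  using (Symmetric; Irreflexive; Decidable)
open import Relation.Binary.Structures using (IsStrictTotalOrder)
open import Relation.Binary.PropositionalEquality using (_≡_)
open import Relation.Nullary using (¬_)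
open import Relation.Unary using (Pred)

------------------------------------------------------------------------
-- Ordered graphs

record Graph (n : ℕ) : Set₁ where
  infix 4 _~_
  field
    V        : Set
    labels   : Fin n ↔ V
    _~_      : Rel V 0ℓ
    ~-sym    : Symmetric _~_
    ~-irrefl : Irreflexive _≡_ _~_
    _~?_     : Decidable _~_

record OrderedGraph (n : ℕ) : Set₁ where
  infix 4 _≺_
  field
    graph   : Graph n
  open Graph graph public
  field
    _≺_     : Rel V 0ℓ
    ≺-total : IsStrictTotalOrder _≡_ _≺_

module _ {n : ℕ} (G : OrderedGraph n) where
  open OrderedGraph G

  -- v lists the vertices as v₁ ≺ … ≺ vₙ.
  record OrderedAlongHamiltonianPath : Set where
    field
      v           : Fin n → V
      surjective  : Surjective _≡_ _≡_ v
      increasing  : ∀ {i j} → i Fin.< j → v i ≺ v j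
      consecutive : ∀ {i j} → toℕ j ≡ suc (toℕ i) → v i ~ v j

  -- Sets of (unoriented) edges, as symmetric subrelations of adjacency.
  record EdgeSet : Set₁ where
    field
      _∋_,_     : Rel V 0ℓ
      symmetric : Symmetric _∋_,_
      edges     : ∀ {u v} → _∋_,_ u v → u ~ v

  open EdgeSet using (_∋_,_)

  NonCrossing : EdgeSet → Set
  NonCrossing S = ∀ {a b c d} → S ∋ a , b → S ∋ c , d →
                  ¬ (a ≺ c × c ≺ b × b ≺ d)

  KNonCrossing : ℕ → Set₁
  KNonCrossing k =
    Σ (Fin k → EdgeSet) λ S →
      (∀ {u v} → u ~ v → ∃! _≡_ λ i → S i ∋ u , v) ×
      (∀ i → NonCrossing (S i))

record InducedPath {n : ℕ} (G : Graph n) (m : ℕ) : Set where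
  open Graph G
  field
    w         : Fin m → V
    injective : Injective _≡_ _≡_ w
    induced   : ∀ i j → w i ~ w j ⇔
                (toℕ j ≡ suc (toℕ i) ⊎ toℕ i ≡ suc (toℕ j))

------------------------------------------------------------------------
-- Real numbers, given by the rationals strictly below and strictly above.
--
-- Only the two halves of the Dedekind cut are carried, not the cut laws.
-- The operations log₂, _⊗_, _⊘_ and root give the intended cuts only when
-- their real arguments are positive and the index of root is nonzero; so
-- x ⊘ log₂ (log₂ n) is meaningful for n ≥ 3.

record ℝ : Set₁ where
  field
    below : Pred ℚ 0ℓ
    above : Pred ℚ 0ℓ

open ℝ public

infix  4 _≤ᵣ_
infixl 7 _⊗_ _⊘_

_≤ᵣ_ : ℝ → ℝ → Set
x ≤ᵣ y = ∀ q → below x q → below y q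

fromℚ : ℚ → ℝ
fromℚ a = record { below = λ q → q < a ; above = λ q → a < q }

fromℕ : ℕ → ℝ
fromℕ n = fromℚ (+ n / 1)

2^ : ℤ → ℚ
2^ (+ r)    = (+ 2 / 1) ^ r
2^ -[1+ r ] = ½ ^ suc r

-- For q = r/s and y > 0, 2^q < y means 2^r < y^s.
log₂ : ℝ → ℝ
log₂ x = record
  { below = λ q → ∃ λ y → 0ℚ < y × below x y × 2^ (↥ q) < y ^ (↧ₙ q)
  ; above = λ q → ∃ λ y → 0ℚ < y × above x y × y ^ (↧ₙ q) < 2^ (↥ q)
  }

_⊗_ : ℝ → ℝ → ℝ
x ⊗ y = record
  { below = λ q → ∃₂ λ a b → 0ℚ < a × 0ℚ < b × below x a × below y b × q < a * b
  ; above = λ q → ∃₂ λ a b → above x a × above y b × a * b < q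
  }

-- x / y, tested by cross-multiplying with a rational bound b > 0 on y.
_⊘_ : ℝ → ℝ → ℝ
x ⊘ y = record
  { below = λ q → ∃₂ λ a b → 0ℚ < b × below x a × above y b × q * b < a
  ; above = λ q → ∃₂ λ a b → 0ℚ < b × above x a × below y b × a < q * b
  }

-- x^(1/p)
root : ℕ → ℝ → ℝ
root p x = record
  { below = λ q → q < 0ℚ ⊎ below x (q ^ p)
  ; above = λ q → 0ℚ < q × above x (q ^ p)
  }

module Submission where

-- Suppose that no induced path has m vertices.  Every interval [ x , y ] of the
-- order contains an induced x–y path, so each vertex s reaches the right end of
-- any window in fewer than m steps through vertices ≥ s, and the left end in
-- fewer than m steps through vertices ≤ s.  Cut a window into F blocks.  If some
-- block sends no edge across the left (or right) end of the window, the vertices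
-- in it leave the block one step sooner on that side than they leave the window;
-- this can be repeated fewer than 2m times.  So a window with at least F ^ (2m)
-- points leads to a smaller window all of whose F blocks have edges across both
-- ends.  By pigeonhole, many of these blocks use the same colour c on the left
-- and d on the right; two such blocks force c ≢ d, and by non-crossing no edge
-- of colour c or d inside the window jumps over a block.  Thus two colours are
-- eliminated at the cost of replacing N blocks by about N ^ (1 / m), and after
-- ⌈ k / 2 ⌉ rounds a path across the window must meet every remaining block.

open import Defs

module Combinatorics where

  open import Data.Nat
    using (ℕ; zero; suc; _+_; _*_; _^_; _≤_; _<_; z≤n; s≤s; _≤?_; _<?_; _≟_;
           NonZero; >-nonZero; ⌊_/2⌋; ⌈_/2⌉)
  open import Data.Nat.Properties
  open import Data.Nat.DivMod using (_mod_; m<n⇒m%n≡m; m%n<n)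
  open import Data.Nat.Solver using (module +-*-Solver)
  open import Data.Fin as Fin using (Fin; toℕ)
  open import Data.Fin.Properties using (toℕ-fromℕ<)
  open import Data.List using (List; []; _∷_; length; filter; lookup; allFin)
  open import Data.List.Properties using (filter-notAll; length-tabulate)
  open import Data.List.Membership.Propositional using (_∈_; _∉_; find; lose)
  open import Data.List.Membership.Propositional.Properties
    using (∈-filter⁺; ∈-allFin; ∈-lookup)
  open import Data.List.Relation.Unary.Any as Any using (Any; here; there; any?)
  open import Data.List.Relation.Unary.All as All using (All; []; _∷_)
  open import Data.List.Relation.Unary.All.Properties using (¬Any⇒All¬)
  open import Data.Product using (∃; ∃₂; _×_; _,_; proj₁; proj₂)
  open import Data.Sum as Sum using (_⊎_; inj₁; inj₂; [_,_]′)
  open import Data.Empty using (⊥)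
  open import Function using (_∘_; id)
  open import Function.Bundles using (mk⇔)
  open import Relation.Nullary using (¬_; Dec; yes; no; contradiction; ¬?)
  open import Relation.Nullary.Decidable using (_×-dec_; _⊎-dec_; map′)
  open import Relation.Unary using (Decidable)
  open import Relation.Binary.Definitions using (tri<; tri≈; tri>)
  open import Relation.Binary.Structures using (IsStrictTotalOrder)
  open import Relation.Binary.PropositionalEquality
    using (_≡_; _≢_; refl; sym; trans; cong; subst; subst₂)

  -- Disjoint intervals listed from left to right

  -- Segs P y x N: N pairwise disjoint intervals [ s , e ] with P s e,
  -- listed from left to right inside [ x , y ].
  data Segs (P : ℕ → ℕ → Set) (y : ℕ) : ℕ → ℕ → Set where
    []  : ∀ {x} → Segs P y x 0
    seg : ∀ {x s e N} → x ≤ s → s ≤ e → e ≤ y → P s e →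
          Segs P y (suc e) N → Segs P y x (suc N)

  module _ {P : ℕ → ℕ → Set} where

    widen : ∀ {y x x′ N} → x′ ≤ x → Segs P y x N → Segs P y x′ N
    widen _    []                 = []
    widen x′≤x (seg x≤s s≤e e≤y p ss) = seg (≤-trans x′≤x x≤s) s≤e e≤y p ss

    take : ∀ {y x M N} → M ≤ N → Segs P y x N → Segs P y x M
    take z≤n       _                      = []
    take (s≤s M≤N) (seg x≤s s≤e e≤y p ss) = seg x≤s s≤e e≤y p (take M≤N ss)

    nonempty⇒x≤y : ∀ {y x N} → Segs P y x (suc N) → x ≤ y
    nonempty⇒x≤y (seg x≤s s≤e e≤y _ _) = ≤-trans x≤s (≤-trans s≤e e≤y)

    dropFirst : ∀ {y x N} → Segs P y x (suc N) →
                ∃ λ x′ → x < x′ × Segs P y x′ N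
    dropFirst (seg x≤s s≤e _ _ ss) = _ , s≤s (≤-trans x≤s s≤e) , ss

    dropLast : ∀ {y x N} → Segs P (suc y) x (suc N) → Segs P y x N
    dropLast (seg _ _ _ _ [])                         = []
    dropLast (seg x≤s s≤e _ p ss@(seg _ _ _ _ _)) =
      seg x≤s s≤e (≤-pred (nonempty⇒x≤y ss)) p (dropLast ss)

    splitAt : ∀ {y x N} g → 1 ≤ g → Segs P y x (g + N) →
              ∃ λ e → x ≤ e × e ≤ y × Segs P e x g × Segs P y (suc e) N
    splitAt 1 _ (seg x≤s s≤e e≤y p ss) =
      _ , ≤-trans x≤s s≤e , e≤y , seg x≤s s≤e ≤-refl p [] , ss
    splitAt (suc g@(suc _)) _ (seg x≤s s≤e e≤y p ss)
      with e′ , e<e′ , e′≤y , ls , rs ← splitAt g (s≤s z≤n) ss =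
      e′ , ≤-trans x≤s (≤-trans s≤e e≤e′) , e′≤y , seg x≤s s≤e e≤e′ p ls , rs
      where e≤e′ = <⇒≤ e<e′

    -- `R` is an outcome that ends the search early, such as a long path met while the intervals are
    -- being processed.
    traverse : ∀ {R : Set} {Q : ℕ → ℕ → Set} {y x N} →
               (∀ {s e} → x ≤ s → s ≤ e → e ≤ y → P s e → R ⊎ Q s e) →
               Segs P y x N → R ⊎ Segs Q y x N
    traverse f [] = inj₂ []
    traverse f (seg x≤s s≤e e≤y p ss) with f x≤s s≤e e≤y p
    ... | inj₁ r = inj₁ r
    ... | inj₂ q with traverse (f ∘ ≤-trans (m≤n⇒m≤1+n (≤-trans x≤s s≤e))) ss
    ...   | inj₁ r  = inj₁ r
    ...   | inj₂ qs = inj₂ (seg x≤s s≤e e≤y q qs)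

    mapSegs : ∀ {Q : ℕ → ℕ → Set} {y x N} →
              (∀ {s e} → x ≤ s → s ≤ e → e ≤ y → P s e → Q s e) →
              Segs P y x N → Segs Q y x N
    mapSegs f ss with traverse {R = ⊥} (λ a b c → inj₂ ∘ f a b c) ss
    ... | inj₂ qs = qs

    -- Each run of `g` intervals is merged into one block, which starts right after the previous
    -- block and ends with its last interval.
    blocks : ∀ {R : Set} {Q : ℕ → ℕ → Set} {y x} g → 1 ≤ g →
             (∀ {a b} → x ≤ a → b ≤ y → Segs P b a g → R ⊎ Q a b) →
             ∀ F → Segs P y x (F * g) → R ⊎ Segs Q y x F
    blocks g 1≤g f zero    ss = inj₂ []
    blocks g 1≤g f (suc F) ss with splitAt g 1≤g ss
    ... | e , x≤e , e≤y , ls , rs with f ≤-refl e≤y ls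
    ...   | inj₁ r = inj₁ r
    ...   | inj₂ q with blocks g 1≤g (f ∘ ≤-trans (m≤n⇒m≤1+n x≤e)) F rs
    ...     | inj₁ r  = inj₁ r
    ...     | inj₂ qs = inj₂ (seg ≤-refl x≤e e≤y q qs)

  partition : ∀ {P Q : ℕ → ℕ → Set} {y x N} → Segs (λ s e → P s e ⊎ Q s e) y x N →
              ∃₂ λ a b → a + b ≡ N × Segs P y x a × Segs Q y x b
  partition [] = 0 , 0 , refl , [] , []
  partition (seg x≤s s≤e e≤y p⊎q ss) with partition ss | p⊎q
  ... | a , b , refl , ps , qs | inj₁ p =
    suc a , b , refl , seg x≤s s≤e e≤y p ps ,
    widen (m≤n⇒m≤1+n (≤-trans x≤s s≤e)) qs
  ... | a , b , refl , ps , qs | inj₂ q =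
    a , suc b , +-suc a b , widen (m≤n⇒m≤1+n (≤-trans x≤s s≤e)) ps ,
    seg x≤s s≤e e≤y q qs

  -- Colours are split off one at a time: either colour zero already has `D` intervals, or fewer
  -- than `D` are lost and the rest suffice for the other colours. `1 ≤ N` excludes `K = 0`, since
  -- some interval has a colour.
  pigeonhole : ∀ K {P : Fin K → ℕ → ℕ → Set} {y x N} D → 1 ≤ N → K * D ≤ N →
               Segs (λ s e → ∃ λ c → P c s e) y x N → ∃ λ c → Segs (P c) y x D
  pigeonhole zero    D 1≤N KD≤N (seg _ _ _ (() , _) _)
  pigeonhole (suc K) {P} D 1≤N KD≤N ss
    with partition {P = P Fin.zero} {Q = λ s e → ∃ λ c → P (Fin.suc c) s e}
           (mapSegs (λ { _ _ _ (Fin.zero , p)  → inj₁ p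
                       ; _ _ _ (Fin.suc c , p) → inj₂ (c , p) }) ss)
  ... | a , b , refl , ps , qs with D ≤? a
  ...   | yes D≤a = Fin.zero , take D≤a ps
  ...   | no  D≰a with pigeonhole K D (≤-trans (s≤s z≤n) KD<b) (<⇒≤ KD<b) qs
    where
    KD<b : K * D < b
    KD<b = +-cancelˡ-< D _ _ (≤-<-trans KD≤N (+-monoˡ-< b (≰⇒> D≰a)))
  ...     | c , cs = Fin.suc c , cs

  -- Discarding the points up to `e` loses at least the one that hits the first interval, while
  -- every later interval keeps its hit.
  hits⇒≤length : ∀ {y x N} (ws : List ℕ) →
                 Segs (λ s e → Any (λ w → s ≤ w × w ≤ e) ws) y x N → N ≤ length ws
  hits⇒≤length ws [] = z≤n
  hits⇒≤length {y} ws (seg {e = e} _ _ _ hit ss) = ≤-<-trans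
    (hits⇒≤length (filter (e <?_) ws) (mapSegs (λ e<s _ _ → later e<s) ss))
    (filter-notAll (e <?_) ws (Any.map (≤⇒≯ ∘ proj₂) hit))
    where
    later : ∀ {s e′} → e < s → Any (λ w → s ≤ w × w ≤ e′) ws →
            Any (λ w → s ≤ w × w ≤ e′) (filter (e <?_) ws)
    later e<s any with find any
    ... | w , w∈ws , s≤w , w≤e′ =
      lose (∈-filter⁺ (e <?_) w∈ws (<-≤-trans e<s s≤w)) (s≤w , w≤e′)

  -- Edge-coloured graphs on positions, and the size threshold

  record ColouredOrder (n k : ℕ) : Set₁ where
    field
      E           : ℕ → ℕ → Set
      E?          : ∀ u v → Dec (E u v)
      E-sym       : ∀ {u v} → E u v → E v u
      E-irrefl    : ∀ {u} → ¬ E u u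
      consecutive : ∀ {i} → suc i < n → E i (suc i)
      Colour      : Fin k → ℕ → ℕ → Set
      colour      : ∀ {u v} → E u v → ∃ λ c → Colour c u v
      noncrossing : ∀ {c a b a′ b′} → a < a′ → a′ < b → b < b′ → b′ < n →
                    Colour c a b → ¬ Colour c a′ b′

  -- T m q disjoint intervals force an induced path on m vertices when at most
  -- 2 * q colours have edges jumping over them.
  T : ℕ → ℕ → ℕ
  T m zero    = m
  T m (suc q) = T m q ^ (5 * m)

  T-closed : ∀ m q → T m q ≡ m ^ ((5 * m) ^ q)
  T-closed m zero    = sym (*-identityʳ m)
  T-closed m (suc q) = begin-equality
    T m q ^ (5 * m)                 ≡⟨ cong (_^ (5 * m)) (T-closed m q) ⟩
    (m ^ ((5 * m) ^ q)) ^ (5 * m)   ≡⟨ ^-*-assoc m ((5 * m) ^ q) (5 * m) ⟩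
    m ^ ((5 * m) ^ q * (5 * m))     ≡⟨ cong (m ^_) (*-comm ((5 * m) ^ q) (5 * m)) ⟩
    m ^ ((5 * m) ^ suc q)           ∎
    where open ≤-Reasoning

  T-expands : ∀ {m} → 1 ≤ m → ∀ q → m ≤ T m q
  T-expands     1≤m zero    = ≤-refl
  T-expands {m} 1≤m (suc q) = begin
    m               ≤⟨ T-expands 1≤m q ⟩
    T m q           ≡⟨ *-identityʳ (T m q) ⟨
    T m q ^ 1       ≤⟨ ^-monoʳ-≤ (T m q) (≤-trans 1≤m (m≤n*m m 5)) ⟩
    T m q ^ (5 * m) ∎
    where
    open ≤-Reasoning
    instance
      T≢0 : NonZero (T m q)
      T≢0 = >-nonZero (≤-trans 1≤m (T-expands 1≤m q))

  -- Induced paths inside an interval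

  module Induced {n k : ℕ} (G : ColouredOrder n k) where
    open ColouredOrder G

    Near : ℕ → ℕ → Set
    Near u w = E u w ⊎ u ≡ w

    near? : ∀ u w → Dec (Near u w)
    near? u w = E? u w ⊎-dec u ≟ w

    -- Path Q t s ws: s ∷ ws is an induced path from s to t inside Q.
    data Path (Q : ℕ → Set) (t : ℕ) : ℕ → List ℕ → Set where
      stop : Q t → Path Q t t []
      step : ∀ {s u ws} → Q s → E s u → All (¬_ ∘ Near s) ws →
             Path Q t u ws → Path Q t s (u ∷ ws)

    weaken : ∀ {Q Q′ : ℕ → Set} {t s ws} → (∀ {u} → Q u → Q′ u) →
             Path Q t s ws → Path Q′ t s ws
    weaken f (stop q)         = stop (f q)
    weaken f (step q e far π) = step (f q) e far (weaken f π)

    head : ∀ {Q t s ws} → Path Q t s ws → Q s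
    head (stop q)       = q
    head (step q _ _ _) = q

    -- Cutting to the last vertex of π near s keeps the path induced.
    attach : ∀ {Q t s u ws} → Q s → Path Q t u ws → Any (Near s) (u ∷ ws) →
             ∃ λ ws′ → Path Q t s ws′
    attach {s = s} {ws = ws} q π near with any? (near? s) ws
    attach q (step _ _ _ π) near | yes near′ = attach q π near′
    attach q π near              | no far with near
    ... | there near′       = contradiction near′ far
    ... | here (inj₁ e)     = _ , step q e (¬Any⇒All¬ _ far) π
    ... | here (inj₂ refl)  = _ , π

    Within : ℕ → ℕ → ℕ → Set
    Within x y u = x ≤ u × u ≤ y

    -- By induction on the length: the Hamiltonian edge puts `x` near the head of an induced path
    -- starting at `suc x`, and `attach` extends that path or a final part of it.
    upwards : ∀ {x y} → x ≤ y → y < n → ∃ λ ws → Path (Within x y) y x ws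
    upwards {x} {y} x≤y y<n with d , refl ← m≤n⇒∃[o]m+o≡n x≤y = go d x y<n
      where
      go : ∀ d x → x + d < n → ∃ λ ws → Path (Within x (x + d)) (x + d) x ws
      go zero    x _ rewrite +-identityʳ x = _ , stop (≤-refl , ≤-refl)
      go (suc d) x x+d<n rewrite +-suc x d =
        attach (≤-refl , m≤n⇒m≤1+n (m≤m+n x d))
          (weaken (λ (x<u , u≤y) → <⇒≤ x<u , u≤y) (proj₂ (go d (suc x) x+d<n)))
          (here (inj₁ (consecutive (≤-<-trans (s≤s (m≤m+n x d)) x+d<n))))

    downwards : ∀ {x y} → x ≤ y → y < n → ∃ λ ws → Path (Within x y) x y ws
    downwards {x} {y} x≤y y<n with d , refl ← m≤n⇒∃[o]m+o≡n x≤y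
      rewrite +-comm x d = go d y<n
      where
      go : ∀ d → d + x < n → ∃ λ ws → Path (Within x (d + x)) x (d + x) ws
      go zero    _ = _ , stop (≤-refl , ≤-refl)
      go (suc d) d+x<n =
        attach (m≤n⇒m≤1+n (m≤n+m x d) , ≤-refl)
          (weaken (λ (x≤u , u≤y) → x≤u , m≤n⇒m≤1+n u≤y)
                  (proj₂ (go d (<-trans ≤-refl d+x<n))))
          (here (inj₁ (E-sym (consecutive d+x<n))))

    -- Walks with a bounded number of edges

    -- Reach Q z i r: r is reached from z by a walk of at most i edges whose
    -- vertices after z lie in Q.
    data Reach (Q : ℕ → Set) (z : ℕ) : ℕ → ℕ → Set where
      here : ∀ {i} → Reach Q z i z
      step : ∀ {i u v} → Reach Q z i u → E u v → Q v → Reach Q z (suc i) v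

    later : ∀ {Q z i r} → Reach Q z i r → Reach Q z (suc i) r
    later here         = here
    later (step ρ e q) = step (later ρ) e q

    ends-in : ∀ {Q z i r} → Q z → Reach Q z i r → Q r
    ends-in q here         = q
    ends-in _ (step _ _ q) = q

    -- Entering `O` costs an edge, so the vertex just before the first entry is reached within the
    -- budget `i`. This is what makes exit budgets drop.
    first-exit : ∀ {Q O : ℕ → Set} {z i r} → Decidable O → ¬ O z →
                 Reach Q z (suc i) r → O r →
                 ∃₂ λ u v → Reach Q z i u × E u v × Q v × ¬ O u × O v
    first-exit O? ¬Oz here Or = contradiction Or ¬Oz
    first-exit O? ¬Oz (step {u = u} ρ e q) Or with O? u
    ... | no ¬Ou = _ , _ , ρ , e , q , ¬Ou , Or
    first-exit O? ¬Oz (step {zero}  here e q) Or | yes Ou = contradiction Ou ¬Oz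
    first-exit O? ¬Oz (step {suc i} ρ e q)    Or | yes Ou
      with u , v , ρ′ , rest ← first-exit O? ¬Oz ρ Ou = u , v , later ρ′ , rest

    reach : ∀ {Q t s ws} i → Path Q t s ws → length ws ≤ i → Reach Q s i t
    reach {Q} {t} {s} i π ws≤i = subst (λ j → Reach Q s j t) (m∸n+n≡m ws≤i) (go here π)
      where
      go : ∀ {u ws j} → Reach Q s j u → Path Q t u ws → Reach Q s (j + length ws) t
      go {j = j} ρ (stop _) rewrite +-identityʳ j = ρ
      go {j = j} ρ (step {ws = ws} _ e _ π)
        rewrite +-suc j (length ws) = go (step ρ e (head π)) π

    -- Narrowing to a window whose blocks all have edges across both ends

    LeftEdge RightEdge : (ℕ → ℕ → Set) → ℕ → ℕ → ℕ → ℕ → Set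
    LeftEdge  R X x s e = ∃₂ λ u v → (X ≤ u × u < x) × (s ≤ v × v ≤ e) × R u v
    RightEdge R y Y s e = ∃₂ λ u v → (s ≤ u × u ≤ e) × (y < v × v ≤ Y) × R u v

    edgeBetween? : ∀ a b c d → Dec (∃₂ λ u v → (a ≤ u × u ≤ b) × (c ≤ v × v ≤ d) × E u v)
    edgeBetween? a b c d = map′
      (λ (u , _ , v , _ , p) → u , v , p)
      (λ { (u , v , p@((_ , u≤b) , (_ , v≤d) , _)) → u , s≤s u≤b , v , s≤s v≤d , p })
      (anyUpTo? (λ u → anyUpTo? (λ v →
        ((a ≤? u) ×-dec (u ≤? b)) ×-dec ((c ≤? v) ×-dec (v ≤? d)) ×-dec E? u v)
        (suc d)) (suc b))

    leftEdge? : ∀ X x s e → Dec (LeftEdge E X x s e)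
    leftEdge? X zero    s e = no λ { (_ , _ , (_ , ()) , _) }
    leftEdge? X (suc x) s e = map′
      (λ { (u , v , (X≤u , u≤x) , p) → u , v , (X≤u , s≤s u≤x) , p })
      (λ { (u , v , (X≤u , s≤s u≤x) , p) → u , v , (X≤u , u≤x) , p })
      (edgeBetween? X x s e)

    rightEdge? : ∀ y Y s e → Dec (RightEdge E y Y s e)
    rightEdge? y Y s e = edgeBetween? s e (suc y) Y

    -- The outer window `[ X , Y ]` stays fixed while `[ x , y ]` shrinks. A left exit uses no
    -- vertex above `s` and a right exit none below `s`, so each approaches only one end.
    LeftExit RightExit : ℕ → ℕ → ℕ → ℕ → Set
    LeftExit  X x j s = ∃ λ r → Reach (Within X s) s j r × r < x
    RightExit y Y i s = ∃ λ r → Reach (Within s Y) s i r × y < r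

    Escapes : ℕ → ℕ → ℕ → ℕ → ℕ → ℕ → ℕ → Set
    Escapes X Y x y i j s = LeftExit X x j s × RightExit y Y i s

    -- A block [ s , e ] of the window [ x , y ] ⊆ [ X , Y ] with an edge satisfying
    -- C across the left end of the window and one satisfying D across the right.
    record Bad (P C D : ℕ → ℕ → Set) (X Y x y s e : ℕ) : Set where
      constructor bad
      field
        left  : LeftEdge C X x s e
        right : RightEdge D y Y s e
        inner : ∃₂ λ s′ e′ → s ≤ s′ × s′ ≤ e′ × e′ ≤ e × P s′ e′

    module _ {P : ℕ → ℕ → Set} {X Y : ℕ} (F : ℕ) (1≤F : 1 ≤ F) where

      private
        Esc : ℕ → ℕ → ℕ → ℕ → ℕ → ℕ → Set
        Esc x y i j s e = P s e × Escapes X Y x y i j s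

        1≤F^ : ∀ t → 1 ≤ F ^ t
        1≤F^ t = subst (_≤ F ^ t) (^-zeroˡ t) (^-monoˡ-≤ t 1≤F)

      -- Induction on `t`, which bounds the sum of the two exit budgets. The intervals form `F`
      -- blocks of `F ^ t`: if every block is bad the window is found, and otherwise a block that is
      -- not becomes the new window with one budget reduced.
      narrow : ∀ t i j → i + j ≤ t → ∀ {x y} → X ≤ x → y ≤ Y →
               Segs (Esc x y i j) y x (F ^ t) →
               ∃₂ λ x′ y′ → X ≤ x′ × y′ ≤ Y × Segs (Bad P E E X Y x′ y′) y′ x′ F
      narrow zero zero j i+j≤t _ _ (seg _ s≤e e≤y (_ , _ , (_ , here , y<s)) _) =
        contradiction y<s (≤⇒≯ (≤-trans s≤e e≤y))
      narrow (suc t) i j i+j≤t {x} {y} X≤x y≤Y ss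
        with blocks (F ^ t) (1≤F^ t) decide F ss
        where
        Result : Set
        Result = ∃₂ λ x′ y′ → X ≤ x′ × y′ ≤ Y × Segs (Bad P E E X Y x′ y′) y′ x′ F

        -- The last vertex `u` before the walk first passes `x` satisfies `u ≤ s ≤ b` and has an
        -- edge past `x`. The block has no such edge, so `u < a`: the walk left the block one edge
        -- earlier. Budget zero is impossible, as `s` itself lies in the window.
        noLeft : ∀ i j → i + j ≤ suc t → ∀ {a b} → x ≤ a → b ≤ y →
                 ¬ LeftEdge E X x a b → Segs (Esc x y i j) b a (F ^ t) → Result
        noLeft i zero _ x≤a b≤y _ ss with F ^ t | 1≤F^ t | ss
        ... | suc _ | _ | seg a≤s _ _ (_ , (_ , here , s<x) , _) _ =
          contradiction s<x (≤⇒≯ (≤-trans x≤a a≤s))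
        noLeft i (suc j) i+j≤t {a} {b} x≤a b≤y none ss =
          narrow t i j (≤-pred (subst (_≤ suc t) (+-suc i j) i+j≤t))
            (≤-trans X≤x x≤a) (≤-trans b≤y y≤Y) (mapSegs shrink ss)
          where
          shrink : ∀ {s e} → a ≤ s → s ≤ e → e ≤ b →
                   Esc x y i (suc j) s e → Esc a b i j s e
          shrink a≤s s≤e e≤b (p , (_ , ρ , r<x) , (r , σ , y<r))
            with u , v , ρ′ , e , (X≤v , _) , u≮x , v<x ←
                 first-exit (_<? x) (≤⇒≯ (≤-trans x≤a a≤s)) ρ r<x =
            p , (u , ρ′ , ≰⇒> λ a≤u → none (v , u , (X≤v , v<x) ,
              (a≤u , ≤-trans (proj₂ (ends-in (≤-trans X≤x (≤-trans x≤a a≤s) , ≤-refl) ρ′))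
                             (≤-trans s≤e e≤b)) , E-sym e))
              , (r , σ , ≤-<-trans b≤y y<r)

        noRight : ∀ i j → i + j ≤ suc t → ∀ {a b} → x ≤ a → b ≤ y →
                  ¬ RightEdge E y Y a b → Segs (Esc x y i j) b a (F ^ t) → Result
        noRight zero j _ x≤a b≤y _ ss with F ^ t | 1≤F^ t | ss
        ... | suc _ | _ | seg _ s≤e e≤b (_ , _ , (_ , here , y<s)) _ =
          contradiction y<s (≤⇒≯ (≤-trans (≤-trans s≤e e≤b) b≤y))
        noRight (suc i) j i+j≤t {a} {b} x≤a b≤y none ss =
          narrow t i j (≤-pred i+j≤t)
            (≤-trans X≤x x≤a) (≤-trans b≤y y≤Y) (mapSegs shrink ss)
          where
          shrink : ∀ {s e} → a ≤ s → s ≤ e → e ≤ b →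
                   Esc x y (suc i) j s e → Esc a b i j s e
          shrink a≤s s≤e e≤b (p , (r , σ , r<x) , (_ , ρ , y<r))
            with u , v , ρ′ , e , (_ , v≤Y) , y≮u , y<v ←
                 first-exit (y <?_) (≤⇒≯ (≤-trans s≤e (≤-trans e≤b b≤y))) ρ y<r =
            p , (r , σ , <-≤-trans r<x x≤a) ,
              (u , ρ′ , ≰⇒> λ u≤b → none (u , v ,
                (≤-trans a≤s (proj₁ (ends-in (≤-refl ,
                  ≤-trans (≤-trans s≤e (≤-trans e≤b b≤y)) y≤Y) ρ′)) , u≤b) ,
                (y<v , v≤Y) , e))

        inside : ∀ {a b N} → 1 ≤ N → Segs (Esc x y i j) b a N →
                 ∃₂ λ s′ e′ → a ≤ s′ × s′ ≤ e′ × e′ ≤ b × P s′ e′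
        inside _ (seg a≤s s≤e e≤b (p , _) _) = _ , _ , a≤s , s≤e , e≤b , p

        decide : ∀ {a b} → x ≤ a → b ≤ y → Segs (Esc x y i j) b a (F ^ t) →
                 Result ⊎ Bad P E E X Y x y a b
        decide {a} {b} x≤a b≤y ss with leftEdge? X x a b | rightEdge? y Y a b
        ... | no none | _       = inj₁ (noLeft i j i+j≤t x≤a b≤y none ss)
        ... | yes _   | no none = inj₁ (noRight i j i+j≤t x≤a b≤y none ss)
        ... | yes l   | yes r   = inj₂ (bad l r (inside (1≤F^ t) ss))
      ... | inj₁ r  = r
      ... | inj₂ bs = x , y , X≤x , y≤Y , bs

    -- Intervals over which edges of few colours jump

    LongPath : ℕ → Set
    LongPath m = ∃₂ λ t s → ∃ λ ws → Path (_< n) t s ws × m ≤ suc (length ws)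

    -- cs are the colours that may still jump over [ s , e ] within [ x , y ].
    Uncovered : List (Fin k) → ℕ → ℕ → ℕ → ℕ → Set
    Uncovered cs x y s e =
      ∀ {c u v} → c ∉ cs → x ≤ u → u < s → e < v → v ≤ y → ¬ Colour c u v

    -- The first vertex of the path at or beyond `a` is entered from below `a`; it cannot lie beyond
    -- `b`, since no edge jumps that far.
    landing : ∀ {Q t s ws a b} → s < a → a ≤ t → Path Q t s ws →
              (∀ {u v} → Q u → Q v → u < a → b < v → ¬ E u v) →
              Any (λ w → a ≤ w × w ≤ b) ws
    landing s<a a≤t (stop _) _ = contradiction s<a (≤⇒≯ a≤t)
    landing {a = a} {b} s<a a≤t (step {u = u} q e _ π) none with u <? a
    ... | yes u<a = there (landing u<a a≤t π none)
    ... | no  u≮a = here (≮⇒≥ u≮a , ≮⇒≥ (λ b<u → none q (head π) s<a b<u e))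

    -- With no colour left, no edge inside the window jumps over any of the intervals, so a path
    -- across the window meets all `m` of them, and they are disjoint.
    allUncovered : ∀ {m x y} → y < n → 1 ≤ m → Segs (Uncovered [] x y) y x m → LongPath m
    allUncovered {suc m} {x} {y} y<n _ ss with ws , π ← upwards (nonempty⇒x≤y ss) y<n =
      y , x , ws , weaken (λ (_ , u≤y) → ≤-<-trans u≤y y<n) π ,
      hits⇒≤length (x ∷ ws) (mapSegs hit ss)
      where
      hit : ∀ {s e} → x ≤ s → s ≤ e → e ≤ y → Uncovered [] x y s e →
            Any (λ w → s ≤ w × w ≤ e) (x ∷ ws)
      hit {s} {e} x≤s s≤e e≤y p with x <? s
      ... | no  x≮s = here (≮⇒≥ x≮s , ≤-trans x≤s s≤e)
      ... | yes x<s = there (landing x<s (≤-trans s≤e e≤y) π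
        λ (x≤u , _) (_ , v≤y) u<s e<v uv →
          p (λ ()) x≤u u<s e<v v≤y (proj₂ (colour uv)))

    -- Eliminating two colours

    open import Data.List.Membership.DecPropositional (Fin._≟_ {k}) using (_∈?_)

    remove : Fin k → List (Fin k) → List (Fin k)
    remove c = filter (λ d → ¬? (c Fin.≟ d))

    length-remove : ∀ {c cs} → c ∈ cs → length (remove c cs) < length cs
    length-remove {c} {cs} c∈cs = filter-notAll _ cs (Any.map (λ c≡d c≢d → c≢d c≡d) c∈cs)

    ∈-remove : ∀ {c d cs} → c ≢ d → d ∈ cs → d ∈ remove c cs
    ∈-remove c≢d d∈cs = ∈-filter⁺ _ d∈cs c≢d

    module _ {cs : List (Fin k)} {X Y x y : ℕ} (Y<n : Y < n) (X≤x : X ≤ x) (y≤Y : y ≤ Y)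
             {c d : Fin k} where

      private
        BadCD : ℕ → ℕ → Set
        BadCD = Bad (Uncovered cs X Y) (Colour c) (Colour d) X Y x y

      -- Two bad blocks suffice: an edge that leaves from one of them in a colour
      -- outside cs would jump over an uncovered interval inside the other.
      c∈cs : ∀ {N} → Segs BadCD y x (2 + N) → c ∈ cs
      c∈cs (seg x≤s _ _ (bad _ _ (s′ , e′ , s≤s′ , s′≤e′ , e′≤e , p))
           (seg e<s₂ _ e₂≤y (bad (u , v , (X≤u , u<x) , (s₂≤v , v≤e₂) , uv) _ _) _))
        with c ∈? cs
      ... | yes c∈ = c∈
      ... | no  c∉ = contradiction uv (p c∉ X≤u (<-≤-trans u<x (≤-trans x≤s s≤s′))
        (≤-<-trans e′≤e (<-≤-trans e<s₂ s₂≤v)) (≤-trans v≤e₂ (≤-trans e₂≤y y≤Y)))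

      d∈cs : ∀ {N} → Segs BadCD y x (2 + N) → d ∈ cs
      d∈cs (seg x≤s _ _ (bad _ (u , v , (s≤u , u≤e) , (y<v , v≤Y) , uv) _)
           (seg e<s₂ _ e₂≤y (bad _ _ (s′ , e′ , s₂≤s′ , s′≤e′ , e′≤e₂ , p)) _))
        with d ∈? cs
      ... | yes d∈ = d∈
      ... | no  d∉ = contradiction uv (p d∉ (≤-trans X≤x (≤-trans x≤s s≤u))
        (≤-<-trans u≤e (<-≤-trans e<s₂ s₂≤s′)) (≤-<-trans (≤-trans e′≤e₂ e₂≤y) y<v) v≤Y)

      -- In a common colour, the left edge of the second block would cross the right edge of the
      -- first.
      c≢d : ∀ {N} → Segs BadCD y x (2 + N) → c ≢ d
      c≢d (seg x≤s _ _ (bad _ (u , v , (s≤u , u≤e) , (y<v , v≤Y) , uv) _)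
          (seg e<s₂ _ e₂≤y (bad (u₂ , v₂ , (X≤u₂ , u₂<x) , (s₂≤v₂ , v₂≤e₂) , uv₂) _ _) _)) refl =
        noncrossing (<-≤-trans u₂<x (≤-trans x≤s s≤u)) (≤-<-trans u≤e (<-≤-trans e<s₂ s₂≤v₂))
          (≤-<-trans (≤-trans v₂≤e₂ e₂≤y) y<v) (≤-<-trans v≤Y Y<n) uv₂ uv

      -- Inside the window, an edge of colour `c` over the block would cross the block's left edge,
      -- and one of colour `d` its right edge. An edge of a colour outside `cs` would jump over the
      -- interval kept inside the block.
      uncovered : ∀ {s e} → x ≤ s → e ≤ y → BadCD s e →
                  Uncovered (remove d (remove c cs)) x y s e
      uncovered x≤s e≤y (bad (u , v , (X≤u , u<x) , (s≤v , v≤e) , uv)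
                             (u₂ , v₂ , (s≤u₂ , u₂≤e) , (y<v₂ , v₂≤Y) , uv₂)
                             (s′ , e′ , s≤s′ , s′≤e′ , e′≤e , p))
                {b} {u₃} {v₃} b∉ x≤u₃ u₃<s e<v₃ v₃≤y uv₃ with c Fin.≟ b | d Fin.≟ b
      ... | yes refl | _ = noncrossing (<-≤-trans u<x x≤u₃) (<-≤-trans u₃<s s≤v)
        (≤-<-trans v≤e e<v₃) (≤-<-trans (≤-trans v₃≤y y≤Y) Y<n) uv uv₃
      ... | no _     | yes refl = noncrossing (<-≤-trans u₃<s s≤u₂) (≤-<-trans u₂≤e e<v₃)
        (≤-<-trans v₃≤y y<v₂) (≤-<-trans v₂≤Y Y<n) uv₃ uv₂
      ... | no c≢b   | no d≢b = p (λ b∈ → b∉ (∈-remove d≢b (∈-remove c≢b b∈)))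
        (≤-trans X≤x x≤u₃) (<-≤-trans u₃<s s≤s′) (≤-<-trans e′≤e e<v₃)
        (≤-trans v₃≤y y≤Y) uv₃

    -- Pigeonhole on the left colours and then on the right ones, each at the cost of a factor `k`.
    pairColours : ∀ D {P X Y x y} → 1 ≤ D → 1 ≤ k →
                  Segs (Bad P E E X Y x y) y x (k * (k * D)) →
                  ∃₂ λ c d → Segs (Bad P (Colour c) (Colour d) X Y x y) y x D
    pairColours D {P} {X} {Y} {x} {y} 1≤D 1≤k ss =
      let c , ss₁ = pigeonhole k {λ c → Bad P (Colour c) E X Y x y} (k * D)
                      (*-mono-≤ 1≤k 1≤kD) ≤-refl (mapSegs (λ _ _ _ → colourLeft) ss)
          d , ss₂ = pigeonhole k {λ d → Bad P (Colour c) (Colour d) X Y x y} D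
                      1≤kD ≤-refl (mapSegs (λ _ _ _ → colourRight) ss₁)
      in c , d , ss₂
      where
      1≤kD : 1 ≤ k * D
      1≤kD = *-mono-≤ 1≤k 1≤D

      colourLeft : ∀ {s e} → Bad P E E X Y x y s e → ∃ λ c → Bad P (Colour c) E X Y x y s e
      colourLeft (bad (u , v , p , q , uv) r i) =
        let c , uv′ = colour uv in c , bad (u , v , p , q , uv′) r i

      colourRight : ∀ {c s e} → Bad P (Colour c) E X Y x y s e →
                    ∃ λ d → Bad P (Colour c) (Colour d) X Y x y s e
      colourRight (bad l (u , v , p , q , uv) i) =
        let d , uv′ = colour uv in d , bad l (u , v , p , q , uv′) i

    -- The rounds of elimination

    module _ {m : ℕ} (1≤k : 1 ≤ k) (large : 2 + k * k ≤ m) where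

      private
        2≤m : 2 ≤ m
        2≤m = ≤-trans (m≤m+n 2 (k * k)) large

      m≤T : ∀ q → m ≤ T m q
      m≤T = T-expands (≤-trans (s≤s z≤n) 2≤m)

      -- One round needs `F ^ (m + m)` intervals with `F = k * (k * t)`, and two more to be dropped
      -- at the ends. As `k * k ≤ t`, the power is at most `t ^ (4 * m)`; the remaining factor
      -- `t ^ m` absorbs the added 2.
      T-step : ∀ q → 2 + (k * (k * T m q)) ^ (m + m) ≤ T m (suc q)
      T-step q = begin
        2 + (k * (k * t)) ^ (m + m)   ≡⟨ cong (λ z → 2 + z ^ (m + m)) (*-assoc k k t) ⟨
        2 + (k * k * t) ^ (m + m)     ≤⟨ +-monoʳ-≤ 2 (^-monoˡ-≤ (m + m) (*-monoˡ-≤ t k²≤t)) ⟩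
        2 + (t * t) ^ (m + m)         ≡⟨ cong (λ z → 2 + (t * z) ^ (m + m)) (*-identityʳ t) ⟨
        2 + (t ^ 2) ^ (m + m)         ≡⟨ cong (2 +_) (^-*-assoc t 2 (m + m)) ⟩
        2 + X                         ≤⟨ +-monoˡ-≤ X (2≤t^ (2 * (m + m)) 1≤4m) ⟩
        X + X                         ≡⟨ cong (X +_) (+-identityʳ X) ⟨
        2 * X                         ≤⟨ *-monoˡ-≤ X (2≤t^ m 1≤m) ⟩
        t ^ m * X                     ≡⟨ ^-distribˡ-+-* t m (2 * (m + m)) ⟨
        t ^ (m + 2 * (m + m))         ≡⟨ cong (t ^_) 5m ⟩
        t ^ (5 * m)                   ∎
        where
        open ≤-Reasoning
        open +-*-Solver
        t = T m q
        X = t ^ (2 * (m + m))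

        1≤m : 1 ≤ m
        1≤m = ≤-trans (s≤s z≤n) 2≤m

        1≤4m : 1 ≤ 2 * (m + m)
        1≤4m = ≤-trans 1≤m (≤-trans (m≤m+n m m) (m≤n*m (m + m) 2))

        5m : m + 2 * (m + m) ≡ 5 * m
        5m = solve 1 (λ a → a :+ con 2 :* (a :+ a) := con 5 :* a) refl m

        2≤t : 2 ≤ t
        2≤t = ≤-trans 2≤m (m≤T q)

        k²≤t : k * k ≤ t
        k²≤t = ≤-trans (m≤n+m (k * k) 2) (≤-trans large (m≤T q))

        instance
          t≢0 : NonZero t
          t≢0 = >-nonZero (≤-trans (s≤s z≤n) 2≤t)

        2≤t^ : ∀ e → 1 ≤ e → 2 ≤ t ^ e
        2≤t^ e 1≤e = begin
          2     ≤⟨ 2≤t ⟩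
          t     ≡⟨ *-identityʳ t ⟨
          t ^ 1 ≤⟨ ^-monoʳ-≤ t 1≤e ⟩
          t ^ e ∎

      -- Induction on the number `q` of rounds: each one either finds a long path or leaves `T m q`
      -- intervals and two colours fewer.
      longPath : ∀ q cs → length cs ≤ 2 * q → ∀ {x y N} → y < n → T m q ≤ N →
                 Segs (Uncovered cs x y) y x N → LongPath m
      longPath zero    [] _ y<n m≤N ss =
        allUncovered y<n (≤-trans (s≤s z≤n) 2≤m) (take m≤N ss)
      longPath (suc q) cs ∣cs∣≤ {X} {Y} Y<n T≤N ss
        -- Dropping the first and the last interval leaves a window strictly inside `[ X , Y ]`, so
        -- that arriving at `X` or at `Y` counts as an exit.
        with x₁ , X<x₁ , ss₁ ← dropFirst (take (≤-trans (T-step q) T≤N) ss)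
        with Y
      ... | zero  = contradiction (≤-trans (s≤s z≤n) X<x₁) (≤⇒≯ (nonempty⇒x≤y ss₁))
      ... | suc Y′ = conclude (traverse split (dropLast ss₁))
        where
        D F : ℕ
        D = T m q
        F = k * (k * D)

        1≤D : 1 ≤ D
        1≤D = ≤-trans (s≤s z≤n) (≤-trans 2≤m (m≤T q))

        P : ℕ → ℕ → Set
        P = Uncovered cs X (suc Y′)

        longEnough : ∀ {Q t s ws} → (∀ {u} → Q u → u < n) → Path Q t s ws →
                     m ≤ suc (length ws) → LongPath m
        longEnough f π m≤ = _ , _ , _ , weaken f π , m≤

        -- An induced path to an end of the outer window either has `m` vertices or is a walk within
        -- the exit budget `m`.
        escape : ∀ {s} → X ≤ s → x₁ ≤ s → s ≤ Y′ → s < n →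
                 LongPath m ⊎ Escapes X (suc Y′) x₁ Y′ m m s
        escape X≤s x₁≤s s≤Y′ s<n
          with ls , λπ ← downwards X≤s s<n
          with rs , ρπ ← upwards (m≤n⇒m≤1+n s≤Y′) Y<n
          with m ≤? suc (length ls) | m ≤? suc (length rs)
        ... | yes m≤ | _ = inj₁ (longEnough (λ (_ , u≤s) → ≤-<-trans u≤s s<n) λπ m≤)
        ... | _ | yes m≤ = inj₁ (longEnough (λ (_ , u≤Y) → ≤-<-trans u≤Y Y<n) ρπ m≤)
        ... | no m≰ls | no m≰rs = inj₂
          ( (X , reach m λπ (<⇒≤ (<⇒≤ (≰⇒> m≰ls))) , X<x₁)
          , (suc Y′ , reach m ρπ (<⇒≤ (<⇒≤ (≰⇒> m≰rs))) , ≤-refl))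

        split : ∀ {s e} → x₁ ≤ s → s ≤ e → e ≤ Y′ → P s e →
                LongPath m ⊎ (P s e × Escapes X (suc Y′) x₁ Y′ m m s)
        split x₁≤s s≤e e≤Y′ p =
          Sum.map₂ (p ,_) (escape (<⇒≤ (<-≤-trans X<x₁ x₁≤s)) x₁≤s s≤Y′
                                  (<-trans (s≤s s≤Y′) Y<n))
          where s≤Y′ = ≤-trans s≤e e≤Y′

        recurse : ∀ {c d x y} → X ≤ x → y ≤ suc Y′ →
                  Segs (Bad P (Colour c) (Colour d) X (suc Y′) x y) y x D → LongPath m
        -- `T m q` is abstracted to show that it is at least 2, which supplies the two bad blocks
        -- behind `c≢d`, `c∈cs` and `d∈cs`.
        recurse {c} {d} {x} {y} X≤x y≤Y ss with T m q | m≤T q | longPath q | ss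
        ... | 0 | m≤0 | _ | _ = contradiction (≤-trans 2≤m m≤0) λ ()
        ... | 1 | m≤1 | _ | _ = contradiction (≤-trans 2≤m m≤1) λ { (s≤s ()) }
        ... | suc (suc _) | _ | rec | ss =
          rec (remove d (remove c cs)) fewer (≤-<-trans y≤Y Y<n) ≤-refl
              (mapSegs (λ x≤s _ e≤y → uncovered Y<n X≤x y≤Y x≤s e≤y) ss)
          where
          fewer : length (remove d (remove c cs)) ≤ 2 * q
          fewer = ≤-pred (≤-pred (≤-trans (s≤s (length-remove
                    (∈-remove (c≢d Y<n X≤x y≤Y ss) (d∈cs Y<n X≤x y≤Y ss))))
                  (≤-trans (length-remove (c∈cs Y<n X≤x y≤Y ss))
                  (subst (length cs ≤_) (cong suc (+-suc q (q + 0))) ∣cs∣≤))))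

        conclude : LongPath m ⊎ Segs (λ s e → P s e × Escapes X (suc Y′) x₁ Y′ m m s)
                                     Y′ x₁ (F ^ (m + m)) → LongPath m
        conclude (inj₁ long) = long
        conclude (inj₂ ss′)
          with x , y , X≤x , y≤Y , bs ← narrow F (*-mono-≤ 1≤k (*-mono-≤ 1≤k 1≤D))
                 (m + m) m m ≤-refl (<⇒≤ X<x₁) (n≤1+n Y′) ss′
          with c , d , cds ← pairColours D 1≤D 1≤k bs = recurse X≤x y≤Y cds

  -- From coloured orders back to the ordered graph

  module _ {n k : ℕ} (G : ColouredOrder n k) where
    open ColouredOrder G
    open Induced G

    singletons : ∀ {P : ℕ → ℕ → Set} {y} → (∀ s e → P s e) →
                 ∀ x N → x + N ≤ suc y → Segs P y x N
    singletons p x zero    _ = []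
    singletons p x (suc N) x+N≤y rewrite +-suc x N =
      seg ≤-refl ≤-refl (≤-trans (m≤m+n x N) (≤-pred x+N≤y)) (p x x)
        (singletons p (suc x) N x+N≤y)

    -- At the start all colours are allowed to jump, so every single vertex is vacuously an
    -- uncovered interval.
    longPathIn : ∀ {m} q → 1 ≤ k → 2 + k * k ≤ m → k ≤ 2 * q → 1 ≤ n → T m q ≤ n → LongPath m
    longPathIn {m} q 1≤k large k≤2q (s≤s {n = n′} _) T≤n =
      longPath 1≤k large q (allFin k) (≤-trans (≤-reflexive (length-tabulate id)) k≤2q)
        ≤-refl T≤n (singletons {P = Uncovered (allFin k) 0 n′}
          (λ _ _ {c} c∉ → contradiction (∈-allFin c) c∉) 0 (suc n′) ≤-refl)

    Path-All : ∀ {Q t s ws} → Path Q t s ws → All Q (s ∷ ws)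
    Path-All (stop q)       = q ∷ []
    Path-All (step q _ _ π) = q ∷ Path-All π

    Consecutive : ∀ {m} → Fin m → Fin m → Set
    Consecutive i j = toℕ j ≡ suc (toℕ i) ⊎ toℕ i ≡ suc (toℕ j)

    -- `Near` includes equality, so `far` excludes repeated vertices as well as chords.
    Path-distinct : ∀ {Q t s ws} → Path Q t s ws → ∀ i j →
                    lookup (s ∷ ws) i ≡ lookup (s ∷ ws) j → i ≡ j
    Path-distinct _ Fin.zero Fin.zero _ = refl
    Path-distinct (step _ e _ _) Fin.zero (Fin.suc Fin.zero) refl = contradiction e E-irrefl
    Path-distinct (step _ e _ _) (Fin.suc Fin.zero) Fin.zero refl = contradiction e E-irrefl
    Path-distinct (step _ _ far _) Fin.zero (Fin.suc (Fin.suc j)) eq =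
      contradiction (inj₂ eq) (All.lookup far (∈-lookup j))
    Path-distinct (step _ _ far _) (Fin.suc (Fin.suc i)) Fin.zero eq =
      contradiction (inj₂ (sym eq)) (All.lookup far (∈-lookup i))
    Path-distinct (step _ _ _ π) (Fin.suc i) (Fin.suc j) eq =
      cong Fin.suc (Path-distinct π i j eq)

    Path-consecutive : ∀ {Q t s ws} → Path Q t s ws → ∀ i j →
                       E (lookup (s ∷ ws) i) (lookup (s ∷ ws) j) → Consecutive i j
    Path-consecutive _ Fin.zero Fin.zero e = contradiction e E-irrefl
    Path-consecutive (step _ _ _ _) Fin.zero (Fin.suc Fin.zero) _ = inj₁ refl
    Path-consecutive (step _ _ _ _) (Fin.suc Fin.zero) Fin.zero _ = inj₂ refl
    Path-consecutive (step _ _ far _) Fin.zero (Fin.suc (Fin.suc j)) e =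
      contradiction (inj₁ e) (All.lookup far (∈-lookup j))
    Path-consecutive (step _ _ far _) (Fin.suc (Fin.suc i)) Fin.zero e =
      contradiction (inj₁ (E-sym e)) (All.lookup far (∈-lookup i))
    Path-consecutive (step _ _ _ π) (Fin.suc i) (Fin.suc j) e =
      Sum.map (cong suc) (cong suc) (Path-consecutive π i j e)

    Path-edge : ∀ {Q t s ws} → Path Q t s ws → ∀ i j → toℕ j ≡ suc (toℕ i) →
                E (lookup (s ∷ ws) i) (lookup (s ∷ ws) j)
    Path-edge (step _ e _ _) Fin.zero (Fin.suc Fin.zero) _ = e
    Path-edge (step _ _ _ π) (Fin.suc i) (Fin.suc j) eq = Path-edge π i j (suc-injective eq)

  module _ {n′ k : ℕ} (G : OrderedGraph (suc n′))
           (H : OrderedAlongHamiltonianPath G) (S : KNonCrossing G k) where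

    private
      n = suc n′
    open OrderedGraph G
    open OrderedAlongHamiltonianPath H
    open EdgeSet using (_∋_,_)

    -- `mod` makes the function total; below `n` it changes nothing.
    vertex : ℕ → V
    vertex x = v (x mod n)

    toℕ-mod : ∀ {x} → x < n → toℕ (x mod n) ≡ x
    toℕ-mod {x} x<n = trans (toℕ-fromℕ< (m%n<n x n)) (m<n⇒m%n≡m x<n)

    vertex-mono : ∀ {x y} → x < y → y < n → vertex x ≺ vertex y
    vertex-mono x<y y<n = increasing
      (subst₂ _<_ (sym (toℕ-mod (<-trans x<y y<n))) (sym (toℕ-mod y<n)) x<y)

    vertex-injective : ∀ {x y} → x < n → y < n → vertex x ≡ vertex y → x ≡ y
    vertex-injective {x} {y} x<n y<n eq with <-cmp x y
    ... | tri< x<y _ _ = contradiction (vertex-mono x<y y<n) (IsStrictTotalOrder.irrefl ≺-total eq)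
    ... | tri≈ _ x≡y _ = x≡y
    ... | tri> _ _ y<x = contradiction (vertex-mono y<x x<n)
      (IsStrictTotalOrder.irrefl ≺-total (sym eq))

    colouredOrder : ColouredOrder n k
    colouredOrder = record
      { E           = λ x y → vertex x ~ vertex y
      ; E?          = λ x y → vertex x ~? vertex y
      ; E-sym       = ~-sym
      ; E-irrefl    = ~-irrefl refl
      ; consecutive = λ i+1<n → OrderedAlongHamiltonianPath.consecutive H
          (trans (toℕ-mod i+1<n) (cong suc (sym (toℕ-mod (<-trans ≤-refl i+1<n)))))
      ; Colour      = λ c x y → proj₁ S c ∋ vertex x , vertex y
      ; colour      = λ e → let c , e∈c , _ = proj₁ (proj₂ S) e in c , e∈c
      ; noncrossing = λ a<a′ a′<b b<b′ b′<n ab a′b′ → proj₂ (proj₂ S) _ ab a′b′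
          ( vertex-mono a<a′ (<-trans a′<b (<-trans b<b′ b′<n))
          , vertex-mono a′<b (<-trans b<b′ b′<n)
          , vertex-mono b<b′ b′<n)
      }

    open Induced colouredOrder

    inducedPath : ∀ {t s ws} → Path (_< n) t s ws → InducedPath graph (suc (length ws))
    inducedPath {s = s} {ws} π = record
      { w         = vertex ∘ lookup (s ∷ ws)
      ; injective = λ {i} {j} eq → Path-distinct colouredOrder π i j
          (vertex-injective (inside i) (inside j) eq)
      ; induced   = λ i j → mk⇔ (Path-consecutive colouredOrder π i j)
          [ Path-edge colouredOrder π i j , (λ eq → ~-sym (Path-edge colouredOrder π j i eq)) ]′
      }
      where
      inside : ∀ i → lookup (s ∷ ws) i < n
      inside i = All.lookup (Path-All colouredOrder π) (∈-lookup i)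

    longInducedPath : ∀ {m} q → 1 ≤ k → 2 + k * k ≤ m → k ≤ 2 * q → T m q ≤ n →
                      ∃ λ m′ → InducedPath graph m′ × m ≤ m′
    longInducedPath q 1≤k large k≤2q T≤n
      with _ , _ , _ , π , m≤ ← longPathIn colouredOrder q 1≤k large k≤2q (s≤s z≤n) T≤n =
      _ , inducedPath π , m≤

  -- Choosing the path length for a given number of vertices

  -- For `n` at or above this threshold, `suc m` is at most the logarithm of `n`; the final estimate
  -- compares the iterated logarithm of `n` with the logarithm of `suc m`.
  2^≤T : ∀ {m} q → 2 ≤ m → 2 ^ suc m ≤ T m (suc q)
  2^≤T {m} q 2≤m = begin
    2 ^ suc m       ≤⟨ ^-monoʳ-≤ 2 (+-monoˡ-≤ m 1≤m) ⟩
    2 ^ (m + m)     ≤⟨ ^-monoʳ-≤ 2 (+-monoʳ-≤ m (m≤m+n m (3 * m))) ⟩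
    2 ^ (5 * m)     ≤⟨ ^-monoˡ-≤ (5 * m) (≤-trans 2≤m (T-expands 1≤m q)) ⟩
    T m q ^ (5 * m) ∎
    where
    open ≤-Reasoning
    1≤m = ≤-trans (s≤s z≤n) 2≤m

  -- A discrete intermediate value argument: `f` passes `n` somewhere between `m₀` and `r + m₀`.
  last-below : ∀ (f : ℕ → ℕ) {m₀ n} → f m₀ ≤ n → ∀ r → n < f (r + m₀) →
               ∃ λ m → m₀ ≤ m × f m ≤ n × n < f (suc m)
  last-below f f≤n zero    n<f = contradiction n<f (≤⇒≯ f≤n)
  last-below f {m₀} {n} f≤n (suc r) n<f with f (r + m₀) ≤? n
  ... | yes f≤n′ = r + m₀ , m≤n+m m₀ r , f≤n′ , n<f
  ... | no  f≰n  = last-below f f≤n r (≰⇒> f≰n)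

  -- m is the largest number with m ^ ((5 * m) ^ p) ≤ n.
  inducedPathOfSize : ∀ p k → 1 ≤ k → p ≡ ⌈ k /2⌉ →
                      ∃ λ N → ∀ n → N ≤ n → (G : OrderedGraph n) →
                      OrderedAlongHamiltonianPath G → KNonCrossing G k →
                      ∃₂ λ m m′ → InducedPath (OrderedGraph.graph G) m′ ×
                        1 ≤ m × m ≤ m′ × 2 ^ suc m ≤ n × n < suc m ^ ((5 * suc m) ^ p)
  -- `T-step` holds from `m₀` on, and `T m₀ p ≤ n` lets the search begin there. It can end at
  -- `suc n + m₀` because `T m p` is at least `m`.
  inducedPathOfSize _ k@(suc k′) 1≤k refl = T m₀ p , λ n T≤n G H S →
    conclude n T≤n G H S (last-below (λ m → T m p) T≤n (suc n)
      (≤-trans (m≤m+n (suc n) m₀) (T-expands (s≤s z≤n) p)))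
    where
    p m₀ : ℕ
    p = ⌈ k /2⌉
    m₀ = 2 + k * k

    k≤2p : k ≤ 2 * p
    k≤2p = begin
      k                       ≡⟨ ⌊n/2⌋+⌈n/2⌉≡n k ⟨
      ⌊ k /2⌋ + p             ≤⟨ +-monoˡ-≤ p (⌊n/2⌋≤⌈n/2⌉ k) ⟩
      p + p                   ≡⟨ cong (p +_) (+-identityʳ p) ⟨
      2 * p                   ∎
      where open ≤-Reasoning

    conclude : ∀ n → T m₀ p ≤ n → (G : OrderedGraph n) →
               OrderedAlongHamiltonianPath G → KNonCrossing G k →
               (∃ λ m → m₀ ≤ m × T m p ≤ n × n < T (suc m) p) →
               ∃₂ λ m m′ → InducedPath (OrderedGraph.graph G) m′ ×
                 1 ≤ m × m ≤ m′ × 2 ^ suc m ≤ n × n < suc m ^ ((5 * suc m) ^ p)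
    conclude zero    T≤0 _ _ _ _ =
      contradiction (≤-trans (T-expands {m₀} (s≤s z≤n) p) T≤0) λ ()
    conclude (suc n) _ G H S (m , m₀≤m , T≤n , n<T)
      with m′ , π , m≤m′ ← longInducedPath G H S p 1≤k m₀≤m k≤2p T≤n =
      m , m′ , π , ≤-trans (s≤s z≤n) m₀≤m , m≤m′ ,
      ≤-trans (2^≤T ⌊ k′ /2⌋ (≤-trans (m≤m+n 2 (k * k)) m₀≤m)) T≤n ,
      subst (suc n <_) (T-closed (suc m) p) n<T

-- The numerical estimate: logarithms and roots as cuts

module Rationals where

  open import Data.Nat as ℕ using (ℕ; zero; suc)
  import Data.Nat.Properties as ℕₚ
  open import Data.Nat.Coprimality using (1-coprimeTo) renaming (sym to coprime-sym)
  open import Data.Integer as ℤ using (+_; -[1+_])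
  import Data.Integer.Properties as ℤₚ
  open import Data.Rational
    using (ℚ; 0ℚ; mkℚ; ↥_; ↧ₙ_; toℚᵘ; _/_; _*_; _≤_; _<_; _<?_;
           nonNegative; +-*-rawSemiring; *≤*; *<*)
  open import Data.Rational.Properties
  import Data.Rational.Unnormalised as ℚᵘ
  import Data.Rational.Unnormalised.Properties as ℚᵘₚ
  open import Algebra.Definitions.RawSemiring +-*-rawSemiring using (_^_)
  open import Data.Product using (_,_)
  open import Data.Sum using (inj₁; inj₂)
  open import Relation.Nullary using (yes; no; contradiction)
  open import Relation.Binary.PropositionalEquality
    using (_≡_; refl; sym; trans; cong; subst; subst₂)

  ι : ℕ → ℚ
  ι n = + n / 1

  -- `_/_` normalises by a gcd that is stuck on a variable; the constructor form exposes numerator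
  -- and denominator.
  ι-mkℚ : ∀ n → ι n ≡ mkℚ (+ n) 0 (coprime-sym (1-coprimeTo n))
  ι-mkℚ n = normalize-coprime (coprime-sym (1-coprimeTo n))

  ι-* : ∀ a b → ι (a ℕ.* b) ≡ ι a * ι b
  ι-* a b rewrite ι-mkℚ a | ι-mkℚ b | sym (ℤₚ.pos-* a b) = refl

  ι-^ : ∀ a n → ι (a ℕ.^ n) ≡ ι a ^ n
  ι-^ a zero    = refl
  ι-^ a (suc n) = trans (ι-* a (a ℕ.^ n)) (cong (ι a *_) (ι-^ a n))

  ι-mono-≤ : ∀ {a b} → a ℕ.≤ b → ι a ≤ ι b
  ι-mono-≤ {a} {b} a≤b rewrite ι-mkℚ a | ι-mkℚ b =
    *≤* (ℤₚ.*-monoʳ-≤-nonNeg (+ 1) (ℤ.+≤+ a≤b))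

  ι-cancel-< : ∀ {a b} → ι a < ι b → a ℕ.< b
  ι-cancel-< {a} {b} a<b with b ℕ.≤? a
  ... | yes b≤a = contradiction (<-≤-trans a<b (ι-mono-≤ {b} {a} b≤a)) (<-irrefl refl)
  ... | no  b≰a = ℕₚ.≰⇒> b≰a

  0≤ι : ∀ a → 0ℚ ≤ ι a
  0≤ι a = ι-mono-≤ {0} {a} ℕ.z≤n

  *-mono-≤-nonNeg : ∀ {a b c d} → 0ℚ ≤ a → 0ℚ ≤ d → a ≤ b → c ≤ d → a * c ≤ b * d
  *-mono-≤-nonNeg {a} {b} {c} {d} 0≤a 0≤d a≤b c≤d =
    ≤-trans (*-monoˡ-≤-nonNeg a {{nonNegative 0≤a}} c≤d)
            (*-monoʳ-≤-nonNeg d {{nonNegative 0≤d}} a≤b)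

  0≤^ : ∀ {x} n → 0ℚ ≤ x → 0ℚ ≤ x ^ n
  0≤^ zero _ = *≤* (ℤ.+≤+ ℕ.z≤n)
  0≤^ {x} (suc n) 0≤x = subst (_≤ x * x ^ n) (*-zeroˡ 0ℚ)
    (*-mono-≤-nonNeg ≤-refl (0≤^ n 0≤x) 0≤x (0≤^ n 0≤x))

  ^-mono-≤ : ∀ {x y} n → 0ℚ ≤ x → x ≤ y → x ^ n ≤ y ^ n
  ^-mono-≤ zero    _   _   = ≤-refl
  ^-mono-≤ (suc n) 0≤x x≤y =
    *-mono-≤-nonNeg 0≤x (0≤^ n (≤-trans 0≤x x≤y)) x≤y (^-mono-≤ n 0≤x x≤y)

  -- The rational witness below `n` is replaced by `n` itself, leaving an inequality between natural
  -- numbers.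
  below-log₂ : ∀ {n} q → 0ℚ < q → below (log₂ (fromℕ n)) q →
               2 ℕ.^ ℤ.∣ ↥ q ∣ ℕ.< n ℕ.^ ↧ₙ q
  below-log₂ {n} q@(mkℚ (+ r) d _) _ (y , 0<y , y<n , 2^r<y^s) = ι-cancel-< (begin-strict
    ι (2 ℕ.^ r)     ≡⟨ ι-^ 2 r ⟩
    ι 2 ^ r         <⟨ 2^r<y^s ⟩
    y ^ suc d       ≤⟨ ^-mono-≤ (suc d) (<⇒≤ 0<y) (<⇒≤ y<n) ⟩
    ι n ^ suc d     ≡⟨ ι-^ n (suc d) ⟨
    ι (n ℕ.^ suc d) ∎)
    where open ≤-Reasoning
  below-log₂ (mkℚ -[1+ _ ] _ _) (*<* ()) _

  -- The bound `m ≤ x` is expressed through the rationals above `x`, so that `x` may itself be a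
  -- logarithm.
  above-log₂ : ∀ {x m} q → 0ℚ < q → (∀ {y} → 0ℚ < y → above x y → ι m ≤ y) →
               above (log₂ x) q → m ℕ.^ ↧ₙ q ℕ.< 2 ℕ.^ ℤ.∣ ↥ q ∣
  above-log₂ {m = m} q@(mkℚ (+ r) d _) _ m≤ (y , 0<y , x<y , y^s<2^r) = ι-cancel-< (begin-strict
    ι (m ℕ.^ suc d) ≡⟨ ι-^ m (suc d) ⟩
    ι m ^ suc d     ≤⟨ ^-mono-≤ (suc d) (0≤ι m) (m≤ 0<y x<y) ⟩
    y ^ suc d       <⟨ y^s<2^r ⟩
    ι 2 ^ r         ≡⟨ ι-^ 2 r ⟨
    ι (2 ℕ.^ r)     ∎)
    where open ≤-Reasoning
  above-log₂ (mkℚ -[1+ _ ] _ _) (*<* ()) _ _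

  ^-cancelʳ-< : ∀ a {b c} → a ℕ.^ b ℕ.< a ℕ.^ c → 1 ℕ.≤ a → b ℕ.< c
  ^-cancelʳ-< a {b} {c} a^b<a^c 1≤a with c ℕ.≤? b
  ... | yes c≤b = contradiction a^b<a^c
    (ℕₚ.≤⇒≯ (ℕₚ.^-monoʳ-≤ a {{ℕ.>-nonZero 1≤a}} c≤b))
  ... | no  c≰b = ℕₚ.≰⇒> c≰b

  above-log₂-≥ : ∀ {n M y} → 0ℚ < y → 2 ℕ.^ M ℕ.≤ n → above (log₂ (fromℕ n)) y → ι M ≤ y
  above-log₂-≥ {n} {M} {y@(mkℚ (+ r) d _)} 0<y 2^M≤n n<2^y =
    subst (_≤ y) (sym (ι-mkℚ M)) (*≤* (subst₂ ℤ._≤_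
      (ℤₚ.pos-* M (suc d)) (sym (ℤₚ.*-identityʳ (+ r)))
      (ℤ.+≤+ (ℕₚ.<⇒≤ (^-cancelʳ-< 2 (begin-strict
        2 ℕ.^ (M ℕ.* suc d)     ≡⟨ ℕₚ.^-*-assoc 2 M (suc d) ⟨
        (2 ℕ.^ M) ℕ.^ suc d     ≤⟨ ℕₚ.^-monoˡ-≤ (suc d) 2^M≤n ⟩
        n ℕ.^ suc d             <⟨ above-log₂ {fromℕ n} {n} y 0<y (λ _ → <⇒≤) n<2^y ⟩
        2 ℕ.^ r                 ∎) (ℕ.s≤s ℕ.z≤n))))))
    where open ℕₚ.≤-Reasoning
  above-log₂-≥ {y = mkℚ -[1+ _ ] _ _} (*<* ()) _ _

  -- In logarithms, `log n < X ^ p * log M ≤ X ^ p * log (log n)`, because `M ≤ log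
  -- n`. Hence the quotient is less than `X ^ p`.
  root-bound : ∀ p X M n → 2 ℕ.^ M ℕ.≤ n → n ℕ.< M ℕ.^ (X ℕ.^ p) →
               ∀ {q} → 0ℚ < q →
               below (root p (log₂ (fromℕ n) ⊘ log₂ (log₂ (fromℕ n)))) q → q < ι X
  root-bound p X M n _ _ 0<q (inj₁ q<0) = contradiction (<-trans 0<q q<0) (<-irrefl refl)
  root-bound p X M n 2^M≤n n<M^T {q} 0<q
    (inj₂ (a@(mkℚ i d _) , b@(mkℚ j e _) , 0<b , a<log , loglog<b , qᵖb<a)) with q <? ι X
  ... | yes q<X = q<X
  ... | no  q≮X = contradiction (<-≤-trans (<-trans qᵖb<a a<Tb) Tb≤qᵖb) (<-irrefl refl)
    where
    T = X ℕ.^ p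

    Tb≤qᵖb : ι T * b ≤ q ^ p * b
    Tb≤qᵖb = *-monoʳ-≤-nonNeg b {{nonNegative (<⇒≤ 0<b)}}
      (subst (_≤ q ^ p) (sym (ι-^ X p)) (^-mono-≤ p (0≤ι X) (≮⇒≥ q≮X)))

    0<a : 0ℚ < a
    0<a = ≤-<-trans (subst (_≤ q ^ p * b) (*-zeroˡ 0ℚ)
      (*-mono-≤-nonNeg ≤-refl (<⇒≤ 0<b) (0≤^ p (<⇒≤ 0<q)) (<⇒≤ 0<b))) qᵖb<a

    2^r<n^s : 2 ℕ.^ ℤ.∣ i ∣ ℕ.< n ℕ.^ suc d
    2^r<n^s = below-log₂ {n} a 0<a a<log

    M^s<2^r : M ℕ.^ suc e ℕ.< 2 ℕ.^ ℤ.∣ j ∣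
    M^s<2^r = above-log₂ {log₂ (fromℕ n)} {M} b 0<b
      (λ 0<y → above-log₂-≥ {n} {M} 0<y 2^M≤n) loglog<b

    -- This is `a < T * b` with denominators cleared, read off from exponents of 2.
    cross : ℤ.∣ i ∣ ℕ.* suc e ℕ.< ℤ.∣ j ∣ ℕ.* (T ℕ.* suc d)
    cross = ^-cancelʳ-< 2 (begin-strict
      2 ℕ.^ (ℤ.∣ i ∣ ℕ.* suc e)         ≡⟨ ℕₚ.^-*-assoc 2 ℤ.∣ i ∣ (suc e) ⟨
      (2 ℕ.^ ℤ.∣ i ∣) ℕ.^ suc e         <⟨ ℕₚ.^-monoˡ-< (suc e) 2^r<n^s ⟩
      (n ℕ.^ suc d) ℕ.^ suc e           ≤⟨ ℕₚ.^-monoˡ-≤ (suc e) (ℕₚ.^-monoˡ-≤ (suc d) (ℕₚ.<⇒≤ n<M^T)) ⟩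
      ((M ℕ.^ T) ℕ.^ suc d) ℕ.^ suc e   ≡⟨ cong (ℕ._^ suc e) (ℕₚ.^-*-assoc M T (suc d)) ⟩
      (M ℕ.^ (T ℕ.* suc d)) ℕ.^ suc e   ≡⟨ ℕₚ.^-*-assoc M (T ℕ.* suc d) (suc e) ⟩
      M ℕ.^ (T ℕ.* suc d ℕ.* suc e)     ≡⟨ cong (M ℕ.^_) (ℕₚ.*-comm (T ℕ.* suc d) (suc e)) ⟩
      M ℕ.^ (suc e ℕ.* (T ℕ.* suc d))   ≡⟨ ℕₚ.^-*-assoc M (suc e) (T ℕ.* suc d) ⟨
      (M ℕ.^ suc e) ℕ.^ (T ℕ.* suc d)   ≤⟨ ℕₚ.^-monoˡ-≤ (T ℕ.* suc d) (ℕₚ.<⇒≤ M^s<2^r) ⟩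
      (2 ℕ.^ ℤ.∣ j ∣) ℕ.^ (T ℕ.* suc d) ≡⟨ ℕₚ.^-*-assoc 2 ℤ.∣ j ∣ (T ℕ.* suc d) ⟩
      2 ℕ.^ (ℤ.∣ j ∣ ℕ.* (T ℕ.* suc d)) ∎) (ℕ.s≤s ℕ.z≤n)
      where open ℕₚ.≤-Reasoning

    a<Tb : a < ι T * b
    a<Tb = toℚᵘ-cancel-< (ℚᵘₚ.<-respʳ-≃ (ℚᵘₚ.≃-sym (toℚᵘ-homo-* (ι T) b))
      (subst (λ x → toℚᵘ a ℚᵘ.< toℚᵘ x ℚᵘ.* toℚᵘ b) (sym (ι-mkℚ T)) (ℚᵘ.*<* cross′)))
      where
      numerator : ∀ x → 0ℚ < x → ↥ x ≡ + ℤ.∣ ↥ x ∣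
      numerator (mkℚ (+ _)    _ _) _        = refl
      numerator (mkℚ -[1+ _ ] _ _) (*<* ())

      cross′ : i ℤ.* + (1 ℕ.* suc e) ℤ.< + T ℤ.* j ℤ.* + suc d
      cross′ rewrite numerator a 0<a | numerator b 0<b | ℕₚ.*-identityˡ (suc e)
        | sym (ℤₚ.pos-* ℤ.∣ i ∣ (suc e)) | sym (ℤₚ.pos-* T ℤ.∣ j ∣)
        | sym (ℤₚ.pos-* (T ℕ.* ℤ.∣ j ∣) (suc d))
        | ℕₚ.*-comm T ℤ.∣ j ∣ | ℕₚ.*-assoc ℤ.∣ j ∣ T (suc d) = ℤ.+<+ cross

  -- `root-bound` applies with `X = 5 * suc m`, which is at most `10 * m` since `1 ≤ m`; hence the
  -- constant 1/10.
  tenth-root-bound : ∀ p m m′ n → 1 ℕ.≤ m → m ℕ.≤ m′ → 2 ℕ.^ suc m ℕ.≤ n →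
                     n ℕ.< suc m ℕ.^ ((5 ℕ.* suc m) ℕ.^ p) →
                     fromℚ (+ 1 / 10) ⊗ root p (log₂ (fromℕ n) ⊘ log₂ (log₂ (fromℕ n))) ≤ᵣ fromℕ m′
  tenth-root-bound p m m′ n 1≤m m≤m′ 2^M≤n n<M^T q (a , b , 0<a , 0<b , a<c , b<root , q<ab) =
    begin-strict
      q                    <⟨ q<ab ⟩
      a * b                ≤⟨ *-mono-≤-nonNeg (<⇒≤ 0<a) (0≤ι (10 ℕ.* m)) (<⇒≤ a<c) (<⇒≤ b<10m) ⟩
      c * ι (10 ℕ.* m)     ≡⟨ cong (c *_) (ι-* 10 m) ⟩
      c * (ι 10 * ι m)     ≡⟨ *-assoc c (ι 10) (ι m) ⟨
      c * ι 10 * ι m       ≡⟨ *-identityˡ (ι m) ⟩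
      ι m                  ≤⟨ ι-mono-≤ m≤m′ ⟩
      ι m′                 ∎
    where
    open ≤-Reasoning
    c = + 1 / 10

    5M≤10m : 5 ℕ.* suc m ℕ.≤ 10 ℕ.* m
    5M≤10m = ℕₚ.≤-trans (ℕₚ.*-monoʳ-≤ 5 (ℕₚ.+-monoˡ-≤ m 1≤m))
      (ℕₚ.≤-reflexive (trans (cong (λ z → 5 ℕ.* (m ℕ.+ z)) (sym (ℕₚ.+-identityʳ m)))
                             (sym (ℕₚ.*-assoc 5 2 m))))

    b<10m : b < ι (10 ℕ.* m)
    b<10m = <-≤-trans (root-bound p (5 ℕ.* suc m) (suc m) n 2^M≤n n<M^T 0<b b<root)
                      (ι-mono-≤ 5M≤10m)

open import Data.Nat using (ℕ; _≤_; ⌈_/2⌉)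
open import Data.Rational using (ℚ; 0ℚ; _<_)
open import Data.Product using (∃; _×_)
open import Relation.Binary.PropositionalEquality using (_≡_)

theorem4p5 : ∀ (p : ℕ) → ∃ λ (c : ℚ) → 0ℚ < c ×
    (∀ (k : ℕ) → 1 ≤ k → p ≡ ⌈ k /2⌉ →
    ∃ λ (N : ℕ) → ∀ (n : ℕ) → N ≤ n →
    (G : OrderedGraph n) →
    OrderedAlongHamiltonianPath G →
    KNonCrossing G k →
    ∃ λ (m : ℕ) → InducedPath (OrderedGraph.graph G) m ×
    fromℚ c ⊗ root p (log₂ (fromℕ n) ⊘ log₂ (log₂ (fromℕ n))) ≤ᵣ fromℕ m)
theorem4p5 p = + 1 / 10 , positive⁻¹ (+ 1 / 10) , λ k 1≤k p≡⌈k/2⌉ →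
  let N , large = Combinatorics.inducedPathOfSize p k 1≤k p≡⌈k/2⌉ in
  N , λ n N≤n G H S →
    let m , m′ , π , 1≤m , m≤m′ , 2^≤n , n< = large n N≤n G H S in
    m′ , π , Rationals.tenth-root-bound p m m′ n 1≤m m≤m′ 2^≤n n<
  where
  open import Data.Integer using (+_)
  open import Data.Product using (_,_)
  open import Data.Rational using (_/_)
  open import Data.Rational.Properties using (positive⁻¹)
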